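{- Let $a_n$ be the number of $\pi\in S_n$ avoiding both arrow patterns $(12;1\to 3)$ and $(1;1\to 1)$, with $a_0=1$. For $n\ge 1$, $a_n=\sum_{k=1}^{n-1}(a_k+a_{k-1})(a_{n-k}+a_{n-k-1})$.
   Context: Standard cycle form of $\sigma\in S_n$: product of disjoint cycles (fixed points included), each cycle starting with its largest element, cycles listed in increasing order of largest elements. The fundamental bijection $\theta:S_n\to S_n$ erases the parentheses of the standard cycle form to give a one-line permutation. For $\pi\in S_n$, $\hat\pi=\theta^{ -1}(\pi)$. An arrow pattern $(\nu;H)$ of size $k$: a string $\nu=a_1\dots a_m$ of positive integers and a set $H$ of arrows $b\to c$, with all integers appearing forming $[k]$. $\pi\in S_n$ contains $(\nu;H)$ if there is $X=\{x_1<\dots<x_k\}\subseteq[n]$ with positions $t_1<\dots<t_m$ such that $\pi_{t_1}\cdots\pi_{t_m}=x_{a_1}\cdots x_{a_m}$ and $\hat\pi(x_b)=x_c$ for every arrow $b\to c\in H$; otherwise it avoids it. In particular $\pi$ avoids $(1;1\to1)$ iff $\hat\pi$ has no fixed points. -}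

module Defs where

open import Data.Nat using (ℕ; zero; suc; _+_; _*_; _∸_; _≡ᵇ_; _≤ᵇ_)
open import Data.Bool using (Bool; true; false; _∧_; not; if_then_else_)
open import Data.List using (List; []; _∷_; map; concat; concatMap; length; applyUpTo; _++_; upTo; head)
  renaming (filterᵇ to filter·)
open import Data.Maybe using (Maybe; just; nothing; fromMaybe)
open import Data.Product using (_×_; _,_)
open import Data.Bool.ListAction using (any; all)
open import Data.Nat.ListAction using (sum)

-- Permutations of [n] = {1,…,n} are represented in one-line notation as
-- lists of naturals  π₁ π₂ … πₙ.

[1‥_] : ℕ → List ℕ
[1‥ n ] = applyUpTo suc n

insertions : ℕ → List ℕ → List (List ℕ)
insertions x [] = (x ∷ []) ∷ []
insertions x (y ∷ ys) = (x ∷ y ∷ ys) ∷ map (y ∷_) (insertions x ys)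

perms : List ℕ → List (List ℕ)
perms [] = [] ∷ []
perms (x ∷ xs) = concatMap (insertions x) (perms xs)

S : ℕ → List (List ℕ)
S n = perms [1‥ n ]

-- 1-indexed lookup:  app σ i = σ(i)  (0 if out of range)
app : List ℕ → ℕ → ℕ
app [] _ = 0
app (x ∷ xs) zero = 0
app (x ∷ xs) (suc zero) = x
app (x ∷ xs) (suc (suc i)) = app xs (suc i)

eqList : List ℕ → List ℕ → Bool
eqList [] [] = true
eqList [] (_ ∷ _) = false
eqList (_ ∷ _) [] = false
eqList (x ∷ xs) (y ∷ ys) = (x ≡ᵇ y) ∧ eqList xs ys

orbit : List ℕ → ℕ → ℕ → ℕ → List ℕ
orbit σ zero x m = []
orbit σ (suc f) x m = if x ≡ᵇ m then [] else x ∷ orbit σ f (app σ x) m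

cyc : List ℕ → ℕ → List ℕ
cyc σ m = m ∷ orbit σ (length σ) (app σ m) m

isCycleMax : List ℕ → ℕ → Bool
isCycleMax σ m = all (_≤ᵇ m) (cyc σ m)

standardCycleForm : List ℕ → List (List ℕ)
standardCycleForm σ = map (cyc σ) (filter· (isCycleMax σ) [1‥ length σ ])

-- fundamental bijection θ : erase the parentheses
θ : List ℕ → List ℕ
θ σ = concat (standardCycleForm σ)

-- π̂ = θ⁻¹(π): the (unique) σ ∈ S_n with θ σ = π
-- (the default π is never used, as θ is a bijection of S_n)
hat : List ℕ → List ℕ
hat π = fromMaybe π (head (filter· (λ σ → eqList (θ σ) π) (S (length π))))

subseqs : ℕ → List ℕ → List (List ℕ)
subseqs zero _ = [] ∷ []
subseqs (suc m) [] = []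
subseqs (suc m) (x ∷ xs) = map (x ∷_) (subseqs m xs) ++ subseqs (suc m) xs

record ArrowPattern : Set where
  constructor ⟨_,_,_⟩
  field
    size   : ℕ
    word   : List ℕ
    arrows : List (ℕ × ℕ)
open ArrowPattern public

-- π contains (ν;H): ∃ X = {x₁<…<x_k} ⊆ [n] and positions t₁<…<t_m with
-- π_{t₁}…π_{t_m} = x_{a₁}…x_{a_m} and π̂(x_b) = x_c for all b→c ∈ H
contains : List ℕ → ArrowPattern → Bool
contains π p =
  any (λ X →
         any (λ s → eqList s (map (app X) (word p))) (subseqs (length (word p)) π)
         ∧ all (λ { (b , c) → app (hat π) (app X b) ≡ᵇ app X c }) (arrows p))
      (subseqs (size p) [1‥ length π ])

avoids : List ℕ → ArrowPattern → Bool
avoids π p = not (contains π p)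

pat12 : ArrowPattern
pat12 = ⟨ 3 , 1 ∷ 2 ∷ [] , (1 , 3) ∷ [] ⟩

pat1 : ArrowPattern
pat1 = ⟨ 1 , 1 ∷ [] , (1 , 1) ∷ [] ⟩

a : ℕ → ℕ
a n = length (filter· (λ π → avoids π pat12 ∧ avoids π pat1) (S n))

rhs : ℕ → ℕ
rhs n = sum (map (λ j → let k = suc j in (a k + a (k ∸ 1)) * (a (n ∸ k) + a (n ∸ k ∸ 1))) (upTo (n ∸ 1)))

{-# OPTIONS --safe #-}
module Submission where

-- Cutting π before each left-to-right maximum gives the cycles of π̂, which sends every letter to the
-- next one in its block, or to the maximum of the block if there is none.  Avoidance of (12;1→3) and
-- (1;1→1) thus becomes a condition on the word π alone.  If π avoids both and ends in k, the letters
-- of π above k are consecutive, so π = L B R k with L, R < k < B and B nonempty; moreover L k R and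
-- B lowered by k satisfy the same condition, except that k, respectively n − k, may be a fixed point
-- in last position.  Conversely every such pair of words glues to an avoider.  There are
-- a k + a (k ∸ 1) words of the relaxed kind on [k], whence the convolution.

open import Defs
open import Data.Nat
  using (ℕ; zero; suc; _+_; _*_; _∸_; _≤_; _<_; z≤n; s≤s; s≤s⁻¹; _≡ᵇ_; _≤ᵇ_; _<?_; _≤?_; _≟_;
         _⊓_; _⊔_)
open import Data.Nat.Properties
open import Data.Nat.ListAction using (sum)
open import Data.Bool using (T; Bool; true; false; T?; if_then_else_; not; _∧_)
open import Data.Bool.Properties using (T-∧; T-≡)
open import Data.List
  using (List; []; _∷_; _++_; map; concatMap; filter; length; applyUpTo; upTo; takeWhile;
         dropWhile; cartesianProduct; filterᵇ; head; _∷ʳ_; initLast; _∷ʳ′_)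
open import Data.List.Properties
  using (∷-injective; ∷-injectiveʳ; length-++; length-++-sucʳ; length-map; ++-identityʳ; map-applyUpTo;
         takeWhile++dropWhile; filter-accept; filter-reject; map-id-local; map-∘;
         length-applyUpTo; ∷ʳ-injective; ∷ʳ-injectiveˡ; ++-assoc; map-cong; map-injective;
         filter-all; filter-none; filter-++; applyUpTo-∷ʳ)
open import Data.List.Membership.Propositional using (_∈_; find; lose)
open import Data.List.Membership.Propositional.Properties
open import Data.List.Relation.Binary.Subset.Propositional using (_⊆_)
open import Data.List.Relation.Binary.Permutation.Propositional
  using (_↭_; prep; swap; ↭-refl; ↭-sym; ↭-trans; module PermutationReasoning; ↭⇒↭ₛ)
open import Data.List.Relation.Binary.Permutation.Propositional.Properties
  using (All-resp-↭; ∈-resp-↭; shift; drop-mid; ↭-empty-inv; drop-∷; map⁺; filter-↭; ↭-length;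
         ++⁺ˡ; ++⁺ʳ; ++⁺; ++-comm; ∷↭∷ʳ; ↭-map-inv)
open import Data.List.Relation.Unary.All as All using (All; []; _∷_)
import Data.List.Relation.Unary.All.Properties as All
open import Data.List.Relation.Unary.AllPairs as AllPairs using (AllPairs; []; _∷_)
import Data.List.Relation.Unary.AllPairs.Properties as AllPairs
open import Data.List.Relation.Unary.Any using (here; there)
open import Data.List.Relation.Unary.Unique.Propositional using (Unique)
import Data.List.Relation.Unary.Unique.Propositional.Properties as Unique
open import Data.Product using (∃; ∃₂; _×_; _,_; proj₁; proj₂) renaming (swap to swap×)
open import Data.Sum using (_⊎_; inj₁; inj₂)
open import Function using (_∘_; id; Equivalence)
open import Relation.Nullary using (¬_; contradiction; yes; no)
open import Relation.Binary.PropositionalEquality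
open import Relation.Nullary.Decidable using (dec-true; dec-false)
open import Relation.Binary.Definitions using (Tri; tri<; tri≈; tri>)
open import Data.Maybe using (fromMaybe)
open import Data.List.Relation.Binary.Permutation.Setoid.Properties using (Unique-resp-↭)
open import Data.List.Relation.Unary.Any.Properties using (any⁺; any⁻)
open import Data.Unit using (⊤)
open import Relation.Unary using (Decidable)

private variable
  A B : Set
  P : A → Set
  f g : ℕ → ℕ
  h j k l m n x : ℕ
  u : Bool
  as as′ bs bs′ cs t vs L R π σ : List ℕ

-- Counting in duplicate-free lists

∈-remove : ∀ {x y : A} as {bs} → y ∈ as ++ x ∷ bs → y ≡ x ⊎ y ∈ as ++ bs
∈-remove as y∈ with ∈-++⁻ as y∈
... | inj₁ y∈as = inj₂ (∈-++⁺ˡ y∈as)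
... | inj₂ (here y≡x) = inj₁ y≡x
... | inj₂ (there y∈bs) = inj₂ (∈-++⁺ʳ as y∈bs)

-- Pigeonhole for a relation, so that the correspondence between words need not be made a function.
-- The partner of the head is struck from `ys`; injectivity keeps it from serving any later `x′`.
length-≤-injective : ∀ {R : A → B → Set} {xs ys} → Unique xs →
  (∀ {x} → x ∈ xs → ∃ λ y → y ∈ ys × R x y) →
  (∀ {x x′ y} → R x y → R x′ y → x ≡ x′) →
  length xs ≤ length ys
length-≤-injective [] total inj = z≤n
length-≤-injective {R = R} {x ∷ xs} (x∉xs ∷ u) total inj
  with y , y∈ys , r ← total (here refl)
  with as , bs , refl ← ∈-∃++ y∈ys =
  subst (suc (length xs) ≤_) (sym (length-++-sucʳ as _ _))
    (s≤s (length-≤-injective {R = R} u total′ inj))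
  where
  total′ : ∀ {x′} → x′ ∈ xs → ∃ λ y′ → y′ ∈ as ++ bs × R x′ y′
  total′ x′∈ with y′ , y′∈ , r′ ← total (there x′∈) with ∈-remove as y′∈
  ... | inj₁ refl = contradiction (inj r r′) (All.lookup x∉xs x′∈)
  ... | inj₂ y′∈′ = y′ , y′∈′ , r′

-- Used to get surjectivity of `θ⁻¹` from its injectivity: striking the head of `xs` from both lists
-- preserves the inclusion and the bound on lengths.
Unique-⊆-≥⇒⊇ : {xs ys : List A} → Unique xs → xs ⊆ ys → length ys ≤ length xs → ys ⊆ xs
Unique-⊆-≥⇒⊇ {ys = []} [] sub len ()
Unique-⊆-≥⇒⊇ {xs = x ∷ xs} (x∉xs ∷ u) sub len y∈
  with as , bs , refl ← ∈-∃++ (sub (here refl)) with ∈-remove as y∈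
... | inj₁ refl = here refl
... | inj₂ y∈′ = there (Unique-⊆-≥⇒⊇ u sub′
        (s≤s⁻¹ (subst (_≤ suc (length xs)) (length-++-sucʳ as _ _) len)) y∈′)
  where
  sub′ : xs ⊆ as ++ bs
  sub′ z∈ with ∈-remove as (sub (there z∈))
  ... | inj₁ refl = contradiction refl (All.lookup x∉xs z∈)
  ... | inj₂ z∈′ = z∈′

Unique-concatMap : ∀ {f : A → List B} {xs} → Unique xs →
  (∀ {x} → x ∈ xs → Unique (f x)) →
  (∀ {x y z} → x ∈ xs → y ∈ xs → z ∈ f x → z ∈ f y → x ≡ y) →
  Unique (concatMap f xs)
Unique-concatMap [] uf dis = []
Unique-concatMap {f = f} {x ∷ xs} (x∉xs ∷ u) uf dis =
  Unique.++⁺ (uf (here refl))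
    (Unique-concatMap u (uf ∘ there) (λ p q → dis (there p) (there q))) disjoint
  where
  disjoint : ∀ {z} → ¬ (z ∈ f x × z ∈ concatMap f xs)
  disjoint (z∈fx , z∈) with find (∈-concatMap⁻ f z∈)
  ... | y , y∈ , z∈fy = All.lookup x∉xs y∈ (dis (here refl) (there y∈) z∈fx z∈fy)

length-concatMap : ∀ (f : A → List B) xs → length (concatMap f xs) ≡ sum (map (length ∘ f) xs)
length-concatMap f [] = refl
length-concatMap f (x ∷ xs) =
  trans (length-++ (f x)) (cong (length (f x) +_) (length-concatMap f xs))

-- Both `b` and `b′` are the first entry where `P` fails, so the list determines the cut.
split-unique : ∀ {as as′ bs bs′ : List A} {b b′} → All P as → All P as′ → ¬ P b → ¬ P b′ →
  as ++ b ∷ bs ≡ as′ ++ b′ ∷ bs′ → as ≡ as′ × b ∷ bs ≡ b′ ∷ bs′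
split-unique [] [] _ _ eq = refl , eq
split-unique [] (p ∷ _) ¬b _ refl = contradiction p ¬b
split-unique (p ∷ _) [] _ ¬b′ refl = contradiction p ¬b′
split-unique (_ ∷ ps) (_ ∷ ps′) ¬b ¬b′ eq
  with refl , eq′ ← ∷-injective eq
  with refl , eq″ ← split-unique ps ps′ ¬b ¬b′ eq′ = refl , eq″

-- Enumeration of permutations

∈-insertions⁺ : ∀ x as {bs} → as ++ x ∷ bs ∈ insertions x (as ++ bs)
∈-insertions⁺ x [] {[]} = here refl
∈-insertions⁺ x [] {_ ∷ _} = here refl
∈-insertions⁺ x (y ∷ as) = there (∈-map⁺ (y ∷_) (∈-insertions⁺ x as))

∈-insertions⁻ : ∀ {x} ys {w} → w ∈ insertions x ys →
  ∃₂ λ as bs → ys ≡ as ++ bs × w ≡ as ++ x ∷ bs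
∈-insertions⁻ [] (here refl) = [] , [] , refl , refl
∈-insertions⁻ (y ∷ ys) (here refl) = [] , y ∷ ys , refl , refl
∈-insertions⁻ (y ∷ ys) (there w∈) with v , v∈ , refl ← ∈-map⁻ (y ∷_) w∈
  with as , bs , refl , refl ← ∈-insertions⁻ ys v∈ = y ∷ as , bs , refl , refl

∈-perms⁻ : ∀ xs {π} → π ∈ perms xs → π ↭ xs
∈-perms⁻ [] (here refl) = ↭-refl
∈-perms⁻ (x ∷ xs) π∈ with _ , π∈vs , vs∈ ← ∈-concat⁻′ (map (insertions x) (perms xs)) π∈
  with τ , τ∈ , refl ← ∈-map⁻ (insertions x) vs∈
  with as , bs , refl , refl ← ∈-insertions⁻ τ π∈vs = ↭-trans (shift x as bs) (prep x (∈-perms⁻ xs τ∈))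

∈-perms⁺ : ∀ xs {π} → π ↭ xs → π ∈ perms xs
∈-perms⁺ [] p with refl ← ↭-empty-inv p = here refl
∈-perms⁺ (x ∷ xs) p with as , bs , refl ← ∈-∃++ (∈-resp-↭ (↭-sym p) (here refl)) =
  ∈-concat⁺′ (∈-insertions⁺ x as) (∈-map⁺ (insertions x) (∈-perms⁺ xs (drop-mid as [] p)))

Unique-insertions : ∀ {x ys} → All (x ≢_) ys → Unique (insertions x ys)
Unique-insertions {ys = []} [] = [] ∷ []
Unique-insertions {x} {y ∷ ys} (x≢y ∷ x∉ys) =
  All.tabulate distinct ∷ Unique.map⁺ ∷-injectiveʳ (Unique-insertions x∉ys)
  where
  distinct : ∀ {w} → w ∈ map (y ∷_) (insertions x ys) → x ∷ y ∷ ys ≢ w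
  distinct w∈ refl with _ , _ , refl ← ∈-map⁻ (y ∷_) w∈ = x≢y refl

Unique-perms : ∀ {xs} → Unique xs → Unique (perms xs)
Unique-perms [] = [] ∷ []
Unique-perms {x ∷ xs} (x∉xs ∷ u) = Unique-concatMap (Unique-perms u)
  (Unique-insertions ∘ avoid) separate
  where
  avoid : ∀ {ys} → ys ∈ perms xs → All (x ≢_) ys
  avoid ys∈ = All-resp-↭ (↭-sym (∈-perms⁻ xs ys∈)) x∉xs
  separate : ∀ {ys zs w} → ys ∈ perms xs → zs ∈ perms xs →
             w ∈ insertions x ys → w ∈ insertions x zs → ys ≡ zs
  separate {ys} {zs} ys∈ zs∈ p q
    -- `x` occurs in neither `ys` nor `zs`, so its position in `w` is unique and deleting it there
    -- gives both words.
    with as , bs , refl , refl ← ∈-insertions⁻ ys p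
       | as′ , bs′ , refl , eq ← ∈-insertions⁻ zs q
    with refl , eq′ ← split-unique (All.++⁻ˡ as (avoid ys∈)) (All.++⁻ˡ as′ (avoid zs∈))
                        (λ x≢x → x≢x refl) (λ x≢x → x≢x refl) eq
    = cong (as ++_) (∷-injectiveʳ eq′)

-- The interval from 1 to n

[1‥]-sorted : ∀ n → AllPairs _<_ [1‥ n ]
[1‥]-sorted n = AllPairs.applyUpTo⁺₁ suc n (λ i<j _ → s≤s i<j)

Unique-S : ∀ n → Unique (S n)
Unique-S n = Unique-perms (AllPairs.map <⇒≢ ([1‥]-sorted n))

∈-[1‥]⁻ : ∀ {x n} → x ∈ [1‥ n ] → 1 ≤ x × x ≤ n
∈-[1‥]⁻ x∈ with i , i<n , refl ← ∈-applyUpTo⁻ suc x∈ = s≤s z≤n , i<n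

∈-[1‥]⁺ : ∀ {x n} → 1 ≤ x → x ≤ n → x ∈ [1‥ n ]
∈-[1‥]⁺ (s≤s _) x≤n = ∈-applyUpTo⁺ suc x≤n

applyUpTo-+ : ∀ (f : ℕ → A) k l → applyUpTo f (k + l) ≡ applyUpTo f k ++ applyUpTo (f ∘ (k +_)) l
applyUpTo-+ f zero l = refl
applyUpTo-+ f (suc k) l = cong (f 0 ∷_) (applyUpTo-+ (f ∘ suc) k l)

applyUpTo-cong : ∀ {f g : ℕ → A} → (∀ i → f i ≡ g i) → ∀ n → applyUpTo f n ≡ applyUpTo g n
applyUpTo-cong eq zero = refl
applyUpTo-cong eq (suc n) = cong₂ _∷_ (eq 0) (applyUpTo-cong (eq ∘ suc) n)

[1‥]-+ : ∀ k l → [1‥ k + l ] ≡ [1‥ k ] ++ map (k +_) [1‥ l ]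
[1‥]-+ k l = trans (applyUpTo-+ suc k l) (cong ([1‥ k ] ++_)
  (trans (applyUpTo-cong (λ i → sym (+-suc k i)) l) (sym (map-applyUpTo suc (k +_) l))))

app-map-applyUpTo : ∀ (f h : ℕ → ℕ) {n i} → i < n → app (map f (applyUpTo h n)) (suc i) ≡ f (h i)
app-map-applyUpTo f h {suc n} {zero} _ = refl
app-map-applyUpTo f h {suc n} {suc i} (s≤s i<n) = app-map-applyUpTo f (h ∘ suc) i<n

app-map-[1‥] : ∀ (f : ℕ → ℕ) {n x} → x ∈ [1‥ n ] → app (map f [1‥ n ]) x ≡ f x
app-map-[1‥] f x∈ with i , i<n , refl ← ∈-applyUpTo⁻ suc x∈ = app-map-applyUpTo f suc i<n

-- Subsequences

∈-subseqs-suc⁻ : ∀ {m x xs ys} → ys ∈ subseqs (suc m) (x ∷ xs) →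
  (∃ λ zs → zs ∈ subseqs m xs × ys ≡ x ∷ zs) ⊎ ys ∈ subseqs (suc m) xs
∈-subseqs-suc⁻ {m} {x} {xs} ys∈ with ∈-++⁻ (map (x ∷_) (subseqs m xs)) ys∈
... | inj₁ p = inj₁ (∈-map⁻ (x ∷_) p)
... | inj₂ p = inj₂ p

subseqs-length : ∀ m xs {ys} → ys ∈ subseqs m xs → length ys ≡ m
subseqs-length zero xs (here refl) = refl
subseqs-length (suc m) (x ∷ xs) p with ∈-subseqs-suc⁻ {m} p
... | inj₁ (_ , q , refl) = cong suc (subseqs-length m xs q)
... | inj₂ q = subseqs-length (suc m) xs q

subseqs-All : ∀ {P : ℕ → Set} m {xs ys} → All P xs → ys ∈ subseqs m xs → All P ys
subseqs-All zero _ (here refl) = []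
subseqs-All (suc m) (p ∷ ps) ys∈ with ∈-subseqs-suc⁻ {m} ys∈
... | inj₁ (_ , q , refl) = p ∷ subseqs-All m ps q
... | inj₂ q = subseqs-All (suc m) ps q

subseqs-AllPairs : ∀ {R : ℕ → ℕ → Set} m {xs ys} → AllPairs R xs → ys ∈ subseqs m xs → AllPairs R ys
subseqs-AllPairs zero _ (here refl) = []
subseqs-AllPairs (suc m) (p ∷ ps) ys∈ with ∈-subseqs-suc⁻ {m} ys∈
... | inj₁ (_ , q , refl) = subseqs-All m p q ∷ subseqs-AllPairs m ps q
... | inj₂ q = subseqs-AllPairs (suc m) ps q

∈-subseqs-1 : ∀ {x xs} → x ∈ xs → x ∷ [] ∈ subseqs 1 xs
∈-subseqs-1 (here refl) = here refl
∈-subseqs-1 (there {x = y} {xs = xs} x∈) =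
  ∈-++⁺ʳ (map (y ∷_) (subseqs 0 xs)) (∈-subseqs-1 x∈)

subseqs-2-AllPairs : ∀ {R : ℕ → ℕ → Set} xs →
  (∀ {x y} → x ∷ y ∷ [] ∈ subseqs 2 xs → R x y) → AllPairs R xs
subseqs-2-AllPairs [] h = []
subseqs-2-AllPairs (x ∷ xs) h =
  All.tabulate (λ y∈ → h (∈-++⁺ˡ (∈-map⁺ (x ∷_) (∈-subseqs-1 y∈)))) ∷
  subseqs-2-AllPairs xs (λ p → h (∈-++⁺ʳ (map (x ∷_) (subseqs 1 xs)) p))

-- Supplies the set `X` of a pattern occurrence. All later entries of `ys` exceed its head, so the
-- head of `xs` either equals the head of `ys` or is skipped.
∈-subseqs-sorted : ∀ {xs ys} → AllPairs _<_ xs → AllPairs _<_ ys → ys ⊆ xs → ys ∈ subseqs (length ys) xs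
∈-subseqs-sorted {ys = []} _ _ _ = here refl
∈-subseqs-sorted {[]} {y ∷ ys} _ _ sub with () ← sub (here refl)
∈-subseqs-sorted {x ∷ xs} {y ∷ ys} (x< ∷ sx) (y< ∷ sy) sub with sub (here refl)
... | here refl = ∈-++⁺ˡ (∈-map⁺ (x ∷_) (∈-subseqs-sorted sx sy sub′))
  where
  sub′ : ys ⊆ xs
  sub′ z∈ with sub (there z∈)
  ... | here refl = contradiction (All.lookup y< z∈) (<-irrefl refl)
  ... | there z∈xs = z∈xs
... | there y∈xs = ∈-++⁺ʳ (map (x ∷_) (subseqs (length ys) xs)) (∈-subseqs-sorted sx (y< ∷ sy) sub′)
  where
  sub′ : y ∷ ys ⊆ xs
  sub′ (here refl) = y∈xs
  sub′ (there z∈) with sub (there z∈)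
  ... | here refl = contradiction (<-trans (All.lookup x< y∈xs) (All.lookup y< z∈)) (<-irrefl refl)
  ... | there z∈xs = z∈xs

eqList⇒≡ : ∀ xs ys → T (eqList xs ys) → xs ≡ ys
eqList⇒≡ [] [] _ = refl
eqList⇒≡ (x ∷ xs) (y ∷ ys) t with p , q ← Equivalence.to T-∧ t =
  cong₂ _∷_ (≡ᵇ⇒≡ x y p) (eqList⇒≡ xs ys q)

eqList-refl : ∀ xs → T (eqList xs xs)
eqList-refl [] = _
eqList-refl (x ∷ xs) = Equivalence.from T-∧ (≡⇒≡ᵇ x x refl , eqList-refl xs)

-- The fundamental bijection along a word

-- Walk f m x vs: f is the fundamental-bijection preimage along the one-line word … x vs,
-- where m is the maximum of the part up to x, i.e. the first letter of the block containing x.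
data Walk (f : ℕ → ℕ) : ℕ → ℕ → List ℕ → Set where
  end  : ∀ {m x} → f x ≡ m → Walk f m x []
  stay : ∀ {m x z vs} → z < m → f x ≡ z → Walk f m z vs → Walk f m x (z ∷ vs)
  jump : ∀ {m x z vs} → m < z → f x ≡ m → Walk f z z vs → Walk f m x (z ∷ vs)

Walk-cong : All (λ q → f q ≡ g q) (x ∷ vs) → Walk f m x vs → Walk g m x vs
Walk-cong (e ∷ _) (end p) = end (trans (sym e) p)
Walk-cong (e ∷ es) (stay lt p w) = stay lt (trans (sym e) p) (Walk-cong es w)
Walk-cong (e ∷ es) (jump lt p w) = jump lt (trans (sym e) p) (Walk-cong es w)

-- Here `m` is the running maximum. The minimum `m ⊓ z` covers both cases: it is `z` if `z` stays in
-- the block, and `m`, closing the cycle, if `z` opens a new one.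
nextFrom : ℕ → ℕ → List ℕ → ℕ → ℕ
nextFrom m x [] q = m
nextFrom m x (z ∷ vs) q = if q ≡ᵇ x then m ⊓ z else nextFrom (m ⊔ z) z vs q

≡ᵇ-refl : ∀ x → (x ≡ᵇ x) ≡ true
≡ᵇ-refl x = Equivalence.to T-≡ (≡⇒≡ᵇ x x refl)

≢⇒≡ᵇ-false : ∀ {x y} → x ≢ y → (x ≡ᵇ y) ≡ false
≢⇒≡ᵇ-false {x} {y} x≢y with x ≡ᵇ y in eq
... | true = contradiction (≡ᵇ⇒≡ x y (Equivalence.from T-≡ eq)) x≢y
... | false = refl

walk-nextFrom : Unique (x ∷ vs) → All (m ≢_) vs → Walk (nextFrom m x vs) m x vs
walk-nextFrom {vs = []} _ _ = end refl
walk-nextFrom {x} {z ∷ vs} {m} (x∉ ∷ u@(z∉ ∷ _)) (m≢z ∷ m∉) = go (<-cmp m z)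
  where
  here≡ : nextFrom m x (z ∷ vs) x ≡ m ⊓ z
  here≡ rewrite ≡ᵇ-refl x = refl
  -- Letters are distinct, so at every later letter the test against `x` fails and the recursive
  -- value is used.
  later : All (λ q → nextFrom (m ⊔ z) z vs q ≡ nextFrom m x (z ∷ vs) q) (z ∷ vs)
  later = All.map (λ {q} x≢q → cong (if_then (m ⊓ z) else nextFrom (m ⊔ z) z vs q)
                                 (sym (≢⇒≡ᵇ-false (x≢q ∘ sym)))) x∉
  go : Tri (m < z) (m ≡ z) (z < m) → Walk (nextFrom m x (z ∷ vs)) m x (z ∷ vs)
  go (tri≈ _ m≡z _) = contradiction m≡z m≢z
  go (tri< m<z _ _) = jump m<z (trans here≡ (m≤n⇒m⊓n≡m (<⇒≤ m<z)))
    (Walk-cong later (subst (λ k → Walk (nextFrom k z vs) z z vs) (sym (m≤n⇒m⊔n≡n (<⇒≤ m<z)))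
      (walk-nextFrom u z∉)))
  go (tri> _ _ z<m) = stay z<m (trans here≡ (m≥n⇒m⊓n≡n (<⇒≤ z<m)))
    (Walk-cong later (subst (λ k → Walk (nextFrom k z vs) m z vs) (sym (m≥n⇒m⊔n≡m (<⇒≤ z<m)))
      (walk-nextFrom u m∉)))

-- Along a walk f rotates every block one step to the left.
map-walk-↭ : Walk f m x vs → map f (x ∷ vs) ↭ m ∷ vs
map-walk-↭ (end refl) = ↭-refl
map-walk-↭ {m = m} {vs = z ∷ _} (stay _ refl w) = ↭-trans (prep z (map-walk-↭ w)) (swap z m ↭-refl)
map-walk-↭ (jump _ refl w) = prep _ (map-walk-↭ w)

-- Standard cycle form of a walk

sorted-↭⇒≡ : ∀ {xs ys} → AllPairs _<_ xs → AllPairs _<_ ys → xs ↭ ys → xs ≡ ys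
sorted-↭⇒≡ {[]} _ _ p = sym (↭-empty-inv (↭-sym p))
sorted-↭⇒≡ {_ ∷ _} {[]} _ _ p with () ← ↭-empty-inv p
sorted-↭⇒≡ {x ∷ xs} {y ∷ ys} (x< ∷ sx) (y< ∷ sy) p with x≡y
  where
  x≡y : x ≡ y
  x≡y with ∈-resp-↭ p (here refl) | ∈-resp-↭ (↭-sym p) (here refl)
  ... | here eq | _ = eq
  ... | there _ | here eq = sym eq
  ... | there x∈ | there y∈ = contradiction (All.lookup x< y∈) (<⇒≯ (All.lookup y< x∈))
... | refl = cong (x ∷_) (sorted-↭⇒≡ sx sy (drop-∷ p))

module _ (σ : List ℕ) where

  -- The rest of the block reaches up to the next left-to-right maximum; then `app σ` returns to
  -- `m`, where `orbit` stops. The bound on `k` keeps the fuel from running out before that.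
  orbit-block : Walk (app σ) m x vs → ∀ {k} → length vs < k →
    orbit σ k (app σ x) m ≡ takeWhile (_<? m) vs
  orbit-block {m = m} (end refl) {suc k} _ rewrite ≡ᵇ-refl m = refl
  orbit-block {m = m} {vs = z ∷ vs} (stay z<m refl w) {suc k} (s≤s lt)
    rewrite ≢⇒≡ᵇ-false (<⇒≢ z<m) | dec-true (z <? m) z<m = cong (z ∷_) (orbit-block w lt)
  orbit-block {m = m} {vs = z ∷ vs} (jump m<z refl w) {suc k} _
    rewrite ≡ᵇ-refl m | dec-false (z <? m) (<⇒≯ m<z) = refl

  -- Now `orbit` waits for a letter `y` that is neither `m` nor ahead, so it runs on to the end of
  -- the block and visits `m`. Taking `y = x` shows that a letter below `m` is not the maximum of
  -- its cycle.
  max∈orbit : Walk (app σ) m x vs → ∀ {y k} → m ≢ y → All (y ≢_) vs → length vs < k →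
    m ∈ orbit σ k (app σ x) y
  max∈orbit (end refl) {k = suc k} m≢y _ _ rewrite ≢⇒≡ᵇ-false m≢y = here refl
  max∈orbit (stay _ refl w) {k = suc k} m≢y (y≢z ∷ y∉) (s≤s lt)
    rewrite ≢⇒≡ᵇ-false (y≢z ∘ sym) = there (max∈orbit w m≢y y∉ lt)
  max∈orbit (jump _ refl w) {k = suc k} m≢y _ _ rewrite ≢⇒≡ᵇ-false m≢y = here refl

  max⇒isCycleMax : Walk (app σ) m m vs → length vs < length σ → T (isCycleMax σ m)
  max⇒isCycleMax {m} {vs} w lt = All.all⁻ (_≤ᵇ m) {m ∷ orbit σ (length σ) (app σ m) m} (≤⇒≤ᵇ (≤-refl {m}) ∷
    subst (All (T ∘ (_≤ᵇ m))) (sym (orbit-block w lt))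
      (All.map (≤⇒≤ᵇ ∘ <⇒≤) (All.all-takeWhile (_<? m) vs)))

  ¬max⇒¬isCycleMax : Walk (app σ) m x vs → x < m → All (x ≢_) vs → length vs < length σ →
    ¬ T (isCycleMax σ x)
  ¬max⇒¬isCycleMax {m} {x} w x<m x∉ lt t with _ ∷ ≤x ← All.all⁺ (_≤ᵇ x) (cyc σ x) t =
    <⇒≱ x<m (≤ᵇ⇒≤ m x (All.lookup ≤x (max∈orbit w (≢-sym (<⇒≢ x<m)) x∉ lt)))

  -- The remaining letters of the current block are no cycle maxima and contribute nothing. At a
  -- jump to `z`, `takeWhile` is the rest of the cycle of `z` and `dropWhile` comes from the
  -- induction.
  cycles-of-walk : Walk (app σ) m x vs → Unique (x ∷ vs) → length vs < length σ →
    concatMap (cyc σ) (filterᵇ (isCycleMax σ) vs) ≡ dropWhile (_<? m) vs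
  cycles-of-walk (end _) _ _ = refl
  cycles-of-walk {m} {vs = z ∷ vs} (stay z<m _ w) (_ ∷ u@(z∉ ∷ _)) lt
    rewrite filter-reject (T? ∘ isCycleMax σ) {xs = vs} (¬max⇒¬isCycleMax w z<m z∉ (<⇒≤ lt))
          | dec-true (z <? m) z<m = cycles-of-walk w u (<⇒≤ lt)
  cycles-of-walk {m} {vs = z ∷ vs} (jump m<z _ w) (_ ∷ u) lt
    rewrite filter-accept (T? ∘ isCycleMax σ) {xs = vs} (max⇒isCycleMax w (<⇒≤ lt))
          | dec-false (z <? m) (<⇒≯ m<z)
          | orbit-block w (<⇒≤ lt) | cycles-of-walk w u (<⇒≤ lt)
    = cong (z ∷_) (takeWhile++dropWhile (_<? z) vs)

  -- Cycle maxima are the left-to-right maxima of the word. Prefixing the current `m` makes the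
  -- induction work.
  cycleMaxima-sorted : Walk (app σ) m x vs → Unique (x ∷ vs) → length vs < length σ →
    AllPairs _<_ (m ∷ filterᵇ (isCycleMax σ) vs)
  cycleMaxima-sorted (end _) _ _ = [] ∷ []
  cycleMaxima-sorted {vs = z ∷ vs} (stay z<m _ w) (_ ∷ u@(z∉ ∷ _)) lt
    rewrite filter-reject (T? ∘ isCycleMax σ) {xs = vs} (¬max⇒¬isCycleMax w z<m z∉ (<⇒≤ lt))
    = cycleMaxima-sorted w u (<⇒≤ lt)
  cycleMaxima-sorted {vs = z ∷ vs} (jump m<z _ w) (_ ∷ u) lt
    rewrite filter-accept (T? ∘ isCycleMax σ) {xs = vs} (max⇒isCycleMax w (<⇒≤ lt))
    with z< ∷ s ← cycleMaxima-sorted w u (<⇒≤ lt)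
    = (m<z ∷ All.map (<-trans m<z) z<) ∷ z< ∷ s

  θ-walk : Walk (app σ) x x vs → Unique (x ∷ vs) → x ∷ vs ↭ [1‥ length σ ] → θ σ ≡ x ∷ vs
  θ-walk {x} {vs} w u p = begin
    θ σ                                                        ≡⟨ cong (concatMap (cyc σ)) (sym maxima≡) ⟩
    concatMap (cyc σ) (filterᵇ (isCycleMax σ) (x ∷ vs))        ≡⟨ cong (concatMap (cyc σ)) accept ⟩
    cyc σ x ++ concatMap (cyc σ) (filterᵇ (isCycleMax σ) vs)   ≡⟨ cong₂ (λ as bs → x ∷ as ++ bs)
                                                                    (orbit-block w lt) (cycles-of-walk w u lt) ⟩
    x ∷ takeWhile (_<? x) vs ++ dropWhile (_<? x) vs           ≡⟨ cong (x ∷_) (takeWhile++dropWhile (_<? x) vs) ⟩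
    x ∷ vs                                                     ∎
    where
    open ≡-Reasoning
    lt : length vs < length σ
    lt = ≤-reflexive (trans (↭-length p) (length-applyUpTo suc (length σ)))
    accept : filterᵇ (isCycleMax σ) (x ∷ vs) ≡ x ∷ filterᵇ (isCycleMax σ) vs
    accept = filter-accept (T? ∘ isCycleMax σ) (max⇒isCycleMax w lt)
    -- `θ` looks for cycle maxima in the interval, not in the word. Both searches give increasing
    -- lists that are rearrangements of each other.
    maxima≡ : filterᵇ (isCycleMax σ) (x ∷ vs) ≡ filterᵇ (isCycleMax σ) [1‥ length σ ]
    maxima≡ = sorted-↭⇒≡ (subst (AllPairs _<_) (sym accept) (cycleMaxima-sorted w u lt))
      (AllPairs.filter⁺ (T? ∘ isCycleMax σ) ([1‥]-sorted (length σ)))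
      (filter-↭ (T? ∘ isCycleMax σ) p)

-- The inverse of θ

next : List ℕ → ℕ → ℕ
next [] q = q
next (x ∷ vs) = nextFrom x x vs

θ⁻¹ : List ℕ → List ℕ
θ⁻¹ π = map (next π) [1‥ length π ]

↭[1‥]⇒length : ∀ {n} → π ↭ [1‥ n ] → length π ≡ n
↭[1‥]⇒length {n = n} p = trans (↭-length p) (length-applyUpTo suc n)

↭[1‥]⇒Unique : ∀ {n} → π ↭ [1‥ n ] → Unique π
↭[1‥]⇒Unique {n = n} p = Unique-resp-↭ (setoid ℕ) (↭⇒↭ₛ (↭-sym p)) (AllPairs.map <⇒≢ ([1‥]-sorted n))

walk-θ⁻¹ : ∀ {n} → x ∷ vs ↭ [1‥ n ] → Walk (app (θ⁻¹ (x ∷ vs))) x x vs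
walk-θ⁻¹ {x} {vs} {n} p with u@(x∉ ∷ _) ← ↭[1‥]⇒Unique p | refl ← ↭[1‥]⇒length p =
  Walk-cong (All.tabulate (λ q∈ → sym (app-map-[1‥] (next (x ∷ vs)) (∈-resp-↭ p q∈))))
    (walk-nextFrom u x∉)

θ⁻¹-↭ : ∀ {n} → π ↭ [1‥ n ] → θ⁻¹ π ↭ [1‥ n ]
θ⁻¹-↭ {[]} {n} p with refl ← ↭[1‥]⇒length p = ↭-refl
θ⁻¹-↭ {x ∷ vs} {n} p with u@(x∉ ∷ _) ← ↭[1‥]⇒Unique p | refl ← ↭[1‥]⇒length p =
  ↭-trans (map⁺ (next (x ∷ vs)) (↭-sym p)) (↭-trans (map-walk-↭ (walk-nextFrom u x∉)) p)

θ-θ⁻¹ : ∀ {n} → π ↭ [1‥ n ] → θ (θ⁻¹ π) ≡ π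
θ-θ⁻¹ {[]} p = refl
θ-θ⁻¹ {x ∷ vs} {n} p = θ-walk (θ⁻¹ (x ∷ vs)) (walk-θ⁻¹ p) (↭[1‥]⇒Unique p)
  (subst (λ k → x ∷ vs ↭ [1‥ k ]) (sym (↭[1‥]⇒length (θ⁻¹-↭ p))) p)

-- As θ⁻¹ is injective on S n, by pigeonhole every σ ∈ S n is the θ⁻¹ of some π.
S⊆map-θ⁻¹-S : ∀ n → σ ∈ S n → σ ∈ map θ⁻¹ (S n)
S⊆map-θ⁻¹-S n = Unique-⊆-≥⇒⊇
  (Unique.map⁻ {f = θ} (subst Unique (sym θ∘θ⁻¹) (Unique-S n)))
  map-θ⁻¹-S⊆S (≤-reflexive (sym (length-map θ⁻¹ (S n))))
  where
  θ∘θ⁻¹ : map θ (map θ⁻¹ (S n)) ≡ S n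
  θ∘θ⁻¹ = trans (sym (map-∘ (S n)))
    (map-id-local (All.tabulate (θ-θ⁻¹ ∘ ∈-perms⁻ [1‥ n ])))
  map-θ⁻¹-S⊆S : map θ⁻¹ (S n) ⊆ S n
  map-θ⁻¹-S⊆S σ∈ with π , π∈ , refl ← ∈-map⁻ θ⁻¹ σ∈ =
    ∈-perms⁺ [1‥ n ] (θ⁻¹-↭ (∈-perms⁻ [1‥ n ] π∈))

θ≡⇒≡θ⁻¹ : ∀ n → σ ∈ S n → θ σ ≡ π → σ ≡ θ⁻¹ π
θ≡⇒≡θ⁻¹ n σ∈ θσ≡π with τ , τ∈ , refl ← ∈-map⁻ θ⁻¹ (S⊆map-θ⁻¹-S n σ∈) =
  cong θ⁻¹ (trans (sym (θ-θ⁻¹ (∈-perms⁻ [1‥ n ] τ∈))) θσ≡π)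

head-∈ : ∀ {d z} {xs : List (List ℕ)} → z ∈ xs → fromMaybe d (head xs) ∈ xs
head-∈ {xs = _ ∷ _} _ = here refl

-- `θ⁻¹ π` is among the hits of the search in `hat`, so the default is never returned; whichever hit
-- comes first is a preimage of `π`, and preimages under `θ` are unique.
hat≡θ⁻¹ : ∀ {n} → π ↭ [1‥ n ] → hat π ≡ θ⁻¹ π
hat≡θ⁻¹ {π} p with refl ← ↭[1‥]⇒length p
  = let hat∈S , t = ∈-filter⁻ hits? {xs = S (length π)} (head-∈ {d = π} θ⁻¹∈)
    in θ≡⇒≡θ⁻¹ (length π) hat∈S (eqList⇒≡ _ π t)
  where
  hits? = λ σ → T? (eqList (θ σ) π)
  θ⁻¹∈ : θ⁻¹ π ∈ filter hits? (S (length π))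
  θ⁻¹∈ = ∈-filter⁺ hits? (∈-perms⁺ [1‥ length π ] (θ⁻¹-↭ p))
    (subst (λ τ → T (eqList τ π)) (sym (θ-θ⁻¹ p)) (eqList-refl π))

walk-hat : ∀ {n} → x ∷ vs ↭ [1‥ n ] → Walk (app (hat (x ∷ vs))) x x vs
walk-hat p = subst (λ σ → Walk (app σ) _ _ _) (sym (hat≡θ⁻¹ p)) (walk-θ⁻¹ p)

-- Avoidance as a condition on the word

-- The avoidance condition read off the one-line word, where m, x and vs are as in Walk: each letter x
-- with image z has no later letter strictly between x and z, and no fixed point occurs, except that
-- the last letter may be one if u holds.
data AvoidsFrom (u : Bool) : ℕ → ℕ → List ℕ → Set where
  end  : ∀ {m x} → T u ⊎ x ≢ m → AvoidsFrom u m x []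
  stay : ∀ {m x z vs} → z < m → All (λ y → x < y → z ≤ y) vs →
         AvoidsFrom u m z vs → AvoidsFrom u m x (z ∷ vs)
  jump : ∀ {m x z vs} → m < z → x ≢ m → All (λ y → x < y → m ≤ y) vs →
         AvoidsFrom u z z vs → AvoidsFrom u m x (z ∷ vs)

Avoids : Bool → List ℕ → Set
Avoids u [] = ⊤
Avoids u (x ∷ vs) = AvoidsFrom u x x vs

-- With `f` the permutation `hat π`, these are avoidance of `pat12` and of `pat1`.
Gapless FixedPointFree : (ℕ → ℕ) → List ℕ → Set
Gapless f = AllPairs (λ x y → x < y → f x ≤ y)
FixedPointFree f = All (λ x → f x ≢ x)

gapless⇒avoidsFrom : Walk f m x vs → Gapless f (x ∷ vs) → FixedPointFree f (x ∷ vs) → AvoidsFrom false m x vs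
gapless⇒avoidsFrom (end refl) _ (p ∷ _) = end (inj₂ (≢-sym p))
gapless⇒avoidsFrom (stay z<m refl w) ((_ ∷ c) ∷ cs) (_ ∷ ps) = stay z<m c (gapless⇒avoidsFrom w cs ps)
gapless⇒avoidsFrom (jump m<z refl w) ((_ ∷ c) ∷ cs) (p ∷ ps) =
  jump m<z (≢-sym p) c (gapless⇒avoidsFrom w cs ps)

-- `AvoidsFrom` omits the pair of `x` and the next letter `z`, which is harmless: `z` is the image
-- of `x` in a `stay` and lies above the image `m` in a `jump`. In a `stay`, `x` is not fixed
-- because letters are distinct.
avoidsFrom⇒gapless : Walk f m x vs → Unique (x ∷ vs) → AvoidsFrom false m x vs →
  Gapless f (x ∷ vs) × FixedPointFree f (x ∷ vs)
avoidsFrom⇒gapless (end refl) _ (end (inj₂ x≢m)) = [] ∷ [] , ≢-sym x≢m ∷ []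
avoidsFrom⇒gapless (stay _ refl w) ((x≢z ∷ _) ∷ u) (stay _ c av) with cs , ps ← avoidsFrom⇒gapless w u av =
  ((λ _ → ≤-refl) ∷ c) ∷ cs , ≢-sym x≢z ∷ ps
avoidsFrom⇒gapless (jump m<z refl w) (_ ∷ u) (jump _ x≢m c av) with cs , ps ← avoidsFrom⇒gapless w u av =
  ((λ _ → <⇒≤ m<z) ∷ c) ∷ cs , ≢-sym x≢m ∷ ps
avoidsFrom⇒gapless (stay z<m _ _) _ (jump m<z _ _ _) = contradiction m<z (<⇒≯ z<m)
avoidsFrom⇒gapless (jump m<z _ _) _ (stay z<m _ _) = contradiction m<z (<⇒≯ z<m)

-- From arrow patterns to words

length-3 : ∀ (X : List ℕ) → length X ≡ 3 → ∃ λ x → ∃₂ λ y z → X ≡ x ∷ y ∷ z ∷ []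
length-3 (x ∷ y ∷ z ∷ []) refl = x , y , z , refl

length-1 : ∀ (X : List ℕ) → length X ≡ 1 → ∃ λ x → X ≡ x ∷ []
length-1 (x ∷ []) refl = x , refl

contains-pat12⁻ : ∀ π → T (contains π pat12) →
  ∃₂ λ x y → x ∷ y ∷ [] ∈ subseqs 2 π × x < y × y < app (hat π) x
contains-pat12⁻ π t with find (any⁻ _ (subseqs 3 [1‥ length π ]) t)
... | X , X∈ , q with x , y , z , refl ← length-3 X (subseqs-length 3 [1‥ length π ] X∈)
  with (x<y ∷ _) ∷ (y<z ∷ _) ∷ _ ← subseqs-AllPairs 3 ([1‥]-sorted (length π)) X∈
  with r , arrow ← Equivalence.to T-∧ q with s , s∈ , eq ← find (any⁻ _ (subseqs 2 π) r) =
  x , y , subst (_∈ subseqs 2 π) (eqList⇒≡ s _ eq) s∈ , x<y ,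
  subst (y <_) (sym (≡ᵇ⇒≡ (app (hat π) x) z (proj₁ (Equivalence.to T-∧ arrow)))) y<z

contains-pat12⁺ : ∀ π {x y} → x ∷ y ∷ [] ∈ subseqs 2 π → x < y → y < app (hat π) x →
  (x ∷ y ∷ app (hat π) x ∷ []) ⊆ [1‥ length π ] → T (contains π pat12)
contains-pat12⁺ π {x} {y} s∈ x<y y<z sub = any⁺ _ (lose X∈ (Equivalence.from T-∧
  (any⁺ _ (lose s∈ (eqList-refl (x ∷ y ∷ []))) , Equivalence.from T-∧ (≡⇒≡ᵇ z z refl , _))))
  where
  z = app (hat π) x
  X∈ : x ∷ y ∷ z ∷ [] ∈ subseqs 3 [1‥ length π ]
  X∈ = ∈-subseqs-sorted ([1‥]-sorted (length π))
    ((x<y ∷ <-trans x<y y<z ∷ []) ∷ (y<z ∷ []) ∷ [] ∷ []) sub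

contains-pat1⁻ : ∀ π → T (contains π pat1) → ∃ λ x → x ∈ π × app (hat π) x ≡ x
contains-pat1⁻ π t with find (any⁻ _ (subseqs 1 [1‥ length π ]) t)
... | X , X∈ , q with x , refl ← length-1 X (subseqs-length 1 [1‥ length π ] X∈)
  with r , arrow ← Equivalence.to T-∧ q with s , s∈ , eq ← find (any⁻ _ (subseqs 1 π) r)
  with refl ← eqList⇒≡ s (x ∷ []) eq
  with x∈ ∷ [] ← subseqs-All 1 (All.tabulate id) s∈ =
  x , x∈ , ≡ᵇ⇒≡ (app (hat π) x) x (proj₁ (Equivalence.to T-∧ arrow))

contains-pat1⁺ : ∀ π → x ∈ π → x ∈ [1‥ length π ] → app (hat π) x ≡ x → T (contains π pat1)
contains-pat1⁺ {x} π x∈ x∈[1‥] eq = any⁺ _ (lose (∈-subseqs-1 x∈[1‥]) (Equivalence.from T-∧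
  (any⁺ _ (lose (∈-subseqs-1 x∈) (eqList-refl (x ∷ []))) ,
   Equivalence.from T-∧ (≡⇒≡ᵇ (app (hat π) x) x eq , _))))

subseqs-2-∈ : ∀ {x y xs} → x ∷ y ∷ [] ∈ subseqs 2 xs → x ∈ xs × y ∈ xs
subseqs-2-∈ s∈ with x∈ ∷ y∈ ∷ [] ← subseqs-All 2 (All.tabulate id) s∈ = x∈ , y∈

T-not⁺ : ∀ {b} → ¬ T b → T (not b)
T-not⁺ {false} _ = _
T-not⁺ {true} ¬t = ¬t _

T-not⁻ : ∀ {b} → T (not b) → ¬ T b
T-not⁻ {true} ()

avoidsBoth : List ℕ → Bool
avoidsBoth π = avoids π pat12 ∧ avoids π pat1

avoidsBoth⇒Avoids : π ↭ [1‥ n ] → T (avoidsBoth π) → Avoids false π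
avoidsBoth⇒Avoids {[]} _ _ = _
avoidsBoth⇒Avoids {x ∷ vs} p t with refl ← ↭[1‥]⇒length p =
  let av12 , av1 = Equivalence.to (T-∧ {avoids (x ∷ vs) pat12}) t in
  gapless⇒avoidsFrom w
    (subseqs-2-AllPairs (x ∷ vs) λ s∈ y<z → ≮⇒≥ λ z<fy →
      let y∈ , z∈ = subseqs-2-∈ s∈ in
      T-not⁻ av12 (contains-pat12⁺ (x ∷ vs) s∈ y<z z<fy λ where
        (here refl) → ∈-resp-↭ p y∈
        (there (here refl)) → ∈-resp-↭ p z∈
        -- The image of a letter is again a letter, since the permutation rotates the blocks of the
        -- word.
        (there (there (here refl))) → ∈-resp-↭ p (∈-resp-↭ (map-walk-↭ w) (∈-map⁺ π̂ y∈))))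
    (All.tabulate λ y∈ fy≡y → T-not⁻ av1 (contains-pat1⁺ (x ∷ vs) y∈ (∈-resp-↭ p y∈) fy≡y))
  where
  π̂ = app (hat (x ∷ vs))
  w : Walk π̂ x x vs
  w = walk-hat p

Avoids⇒avoidsBoth : π ↭ [1‥ n ] → Avoids false π → T (avoidsBoth π)
Avoids⇒avoidsBoth {[]} _ _ = _
Avoids⇒avoidsBoth {x ∷ vs} p av with cs , fs ← avoidsFrom⇒gapless (walk-hat p) (↭[1‥]⇒Unique p) av =
  Equivalence.from (T-∧ {avoids (x ∷ vs) pat12})
    ( T-not⁺ (λ t → let y , z , s∈ , y<z , z<fy = contains-pat12⁻ (x ∷ vs) t
                    in <⇒≱ z<fy (All.head (AllPairs.head (subseqs-AllPairs 2 cs s∈)) y<z))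
    , T-not⁺ (λ t → let y , y∈ , eq = contains-pat1⁻ (x ∷ vs) t in All.lookup fs y∈ eq))

avoiders : ℕ → List (List ℕ)
avoiders n = filterᵇ avoidsBoth (S n)

Unique-avoiders : ∀ n → Unique (avoiders n)
Unique-avoiders n = Unique.filter⁺ (T? ∘ avoidsBoth) (Unique-S n)

∈-avoiders⁺ : ∀ n → π ↭ [1‥ n ] → Avoids false π → π ∈ avoiders n
∈-avoiders⁺ n p av = ∈-filter⁺ (T? ∘ avoidsBoth) (∈-perms⁺ [1‥ n ] p) (Avoids⇒avoidsBoth p av)

∈-avoiders⁻ : ∀ n → π ∈ avoiders n → π ↭ [1‥ n ] × Avoids false π
∈-avoiders⁻ n π∈ = let π∈S , t = ∈-filter⁻ (T? ∘ avoidsBoth) π∈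
                       p = ∈-perms⁻ [1‥ n ] π∈S
                   in p , avoidsBoth⇒Avoids p t

-- A fixed point in last position

AvoidsFrom-weaken : AvoidsFrom false m x vs → AvoidsFrom true m x vs
AvoidsFrom-weaken (end _) = end (inj₁ _)
AvoidsFrom-weaken (stay z<m c av) = stay z<m c (AvoidsFrom-weaken av)
AvoidsFrom-weaken (jump m<z x≢m c av) = jump m<z x≢m c (AvoidsFrom-weaken av)

Avoids-weaken : ∀ π → Avoids false π → Avoids true π
Avoids-weaken [] _ = _
Avoids-weaken (_ ∷ _) = AvoidsFrom-weaken

-- The new letter forms a block of its own, a fixed point that `true` permits. All earlier images
-- are below `k`, so it breaks no earlier condition.
AvoidsFrom-∷ʳ : m < k → All (_< k) vs → AvoidsFrom false m x vs → AvoidsFrom true m x (vs ∷ʳ k)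
AvoidsFrom-∷ʳ m<k _ (end (inj₂ x≢m)) = jump m<k x≢m [] (end (inj₁ _))
AvoidsFrom-∷ʳ m<k (z<k ∷ <k) (stay z<m c av) =
  stay z<m (All.++⁺ c ((λ _ → <⇒≤ z<k) ∷ [])) (AvoidsFrom-∷ʳ m<k <k av)
AvoidsFrom-∷ʳ m<k (z<k ∷ <k) (jump m<z x≢m c av) =
  jump m<z x≢m (All.++⁺ c ((λ _ → <⇒≤ m<k) ∷ [])) (AvoidsFrom-∷ʳ z<k <k av)

Avoids-∷ʳ : ∀ π → All (_< k) π → Avoids false π → Avoids true (π ∷ʳ k)
Avoids-∷ʳ [] _ _ = end (inj₁ _)
Avoids-∷ʳ (_ ∷ _) (x<k ∷ <k) av = AvoidsFrom-∷ʳ x<k <k av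

data LastFixed (m x : ℕ) : List ℕ → Set where
  here-fixed : x ≡ m → LastFixed m x []
  last-fixed : ∀ {vs k} → All (_< k) (x ∷ vs) → m < k → AvoidsFrom false m x vs → LastFixed m x (vs ∷ʳ k)

-- The last letter is fixed only if it has just opened its block. It then exceeds the running
-- maximum, and so every earlier letter; deleting it merely drops conditions on the others.
AvoidsFrom-strengthen : x ≤ m → AvoidsFrom true m x vs → AvoidsFrom false m x vs ⊎ LastFixed m x vs
AvoidsFrom-strengthen {x} {m} _ (end _) with x ≟ m
... | yes x≡m = inj₂ (here-fixed x≡m)
... | no x≢m = inj₁ (end (inj₂ x≢m))
AvoidsFrom-strengthen x≤m (stay z<m c av) with AvoidsFrom-strengthen (<⇒≤ z<m) av
... | inj₁ av′ = inj₁ (stay z<m c av′)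
... | inj₂ (here-fixed refl) = contradiction z<m (<-irrefl refl)
... | inj₂ (last-fixed {ws} <k m<k av′) =
  inj₂ (last-fixed (≤-<-trans x≤m m<k ∷ <k) m<k (stay z<m (All.++⁻ˡ ws c) av′))
AvoidsFrom-strengthen x≤m (jump m<z x≢m c av) with AvoidsFrom-strengthen ≤-refl av
... | inj₁ av′ = inj₁ (jump m<z x≢m c av′)
... | inj₂ (here-fixed _) = inj₂ (last-fixed (≤-<-trans x≤m m<z ∷ []) m<z (end (inj₂ x≢m)))
... | inj₂ (last-fixed {ws} <k z<k av′) =
  inj₂ (last-fixed (≤-<-trans x≤m (<-trans m<z z<k) ∷ <k) (<-trans m<z z<k)
    (jump m<z x≢m (All.++⁻ˡ ws c) av′))

Avoids-strengthen : Avoids true (x ∷ vs) →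
  Avoids false (x ∷ vs) ⊎ ∃₂ λ ws k → x ∷ vs ≡ ws ∷ʳ k × All (_< k) ws × Avoids false ws
Avoids-strengthen av with AvoidsFrom-strengthen ≤-refl av
... | inj₁ av′ = inj₁ av′
... | inj₂ (here-fixed _) = inj₂ ([] , _ , refl , [] , _)
... | inj₂ (last-fixed <k _ av′) = inj₂ (_ , _ , refl , <k , av′)

-- Shifting and gluing words

AvoidsFrom-shift⁺ : ∀ k → AvoidsFrom u m x vs → AvoidsFrom u (k + m) (k + x) (map (k +_) vs)
AvoidsFrom-shift⁺ k (end (inj₁ t)) = end (inj₁ t)
AvoidsFrom-shift⁺ k (end (inj₂ x≢m)) = end (inj₂ (x≢m ∘ +-cancelˡ-≡ k _ _))
AvoidsFrom-shift⁺ k (stay z<m c av) = stay (+-monoʳ-< k z<m)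
  (All.map⁺ (All.map (λ g → +-monoʳ-≤ k ∘ g ∘ +-cancelˡ-< k _ _) c)) (AvoidsFrom-shift⁺ k av)
AvoidsFrom-shift⁺ k (jump m<z x≢m c av) = jump (+-monoʳ-< k m<z) (x≢m ∘ +-cancelˡ-≡ k _ _)
  (All.map⁺ (All.map (λ g → +-monoʳ-≤ k ∘ g ∘ +-cancelˡ-< k _ _) c)) (AvoidsFrom-shift⁺ k av)

AvoidsFrom-shift⁻ : ∀ k {vs} → AvoidsFrom u (k + m) (k + x) (map (k +_) vs) → AvoidsFrom u m x vs
AvoidsFrom-shift⁻ k {[]} (end (inj₁ t)) = end (inj₁ t)
AvoidsFrom-shift⁻ k {[]} (end (inj₂ x≢m)) = end (inj₂ (x≢m ∘ cong (k +_)))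
AvoidsFrom-shift⁻ k {_ ∷ _} (stay z<m c av) = stay (+-cancelˡ-< k _ _ z<m)
  (All.map (λ g → +-cancelˡ-≤ k _ _ ∘ g ∘ +-monoʳ-< k) (All.map⁻ c)) (AvoidsFrom-shift⁻ k av)
AvoidsFrom-shift⁻ k {_ ∷ _} (jump m<z x≢m c av) = jump (+-cancelˡ-< k _ _ m<z) (x≢m ∘ cong (k +_))
  (All.map (λ g → +-cancelˡ-≤ k _ _ ∘ g ∘ +-monoʳ-< k) (All.map⁻ c)) (AvoidsFrom-shift⁻ k av)

-- For the conditions on later letters: these ignore order, so moving `k` to the end is harmless and
-- only the inserted `bs` have to be checked.
All-glue⁺ : ∀ as → All P (as ++ k ∷ cs) → All P bs → All P (as ++ bs ++ cs ∷ʳ k)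
All-glue⁺ as ps qs with ps₁ , p ∷ ps₂ ← All.++⁻ as ps =
  All.++⁺ ps₁ (All.++⁺ qs (All.++⁺ ps₂ (p ∷ [])))

All-glue⁻ : ∀ as bs → All P (as ++ bs ++ cs ∷ʳ k) → All P (as ++ k ∷ cs)
All-glue⁻ {cs = cs} as bs ps with ps₁ , ps₂ ← All.++⁻ as ps with ps₃ , p ∷ [] ← All.++⁻ cs (All.++⁻ʳ bs ps₂) =
  All.++⁺ ps₁ (p ∷ ps₃)

-- The letters of `R` keep their images. In the first word the last of them returns to the maximum
-- `k` of its block; in the glued word it goes to `k` as the next letter, and `k` goes to `m`.
AvoidsFrom-lower⁺ : k < m → All (_< k) vs → AvoidsFrom true k x vs → x < k → AvoidsFrom false m x (vs ∷ʳ k)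
AvoidsFrom-lower⁺ k<m _ (end _) _ = stay k<m [] (end (inj₂ (<⇒≢ k<m)))
AvoidsFrom-lower⁺ k<m (z<k ∷ <k) (stay _ c av) _ =
  stay (<-trans z<k k<m) (All.++⁺ c ((λ _ → <⇒≤ z<k) ∷ [])) (AvoidsFrom-lower⁺ k<m <k av z<k)
AvoidsFrom-lower⁺ k<m (z<k ∷ <k) (jump k<z _ _ _) _ = contradiction k<z (<⇒≯ z<k)

AvoidsFrom-lower⁻ : k < m → All (_< k) vs → AvoidsFrom false m x (vs ∷ʳ k) → AvoidsFrom true k x vs
AvoidsFrom-lower⁻ k<m [] _ = end (inj₁ _)
AvoidsFrom-lower⁻ {vs = _ ∷ vs} k<m (z<k ∷ <k) (stay _ c av) =
  stay z<k (All.++⁻ˡ vs c) (AvoidsFrom-lower⁻ k<m <k av)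
AvoidsFrom-lower⁻ k<m (z<k ∷ <k) (jump m<z _ _ _) = contradiction (<-trans k<m m<z) (<⇒≯ z<k)

-- Letters after the upper part are at most `k` and cannot violate its conditions. Its last letter
-- no longer returns to `m` but steps down to the next letter, so it was allowed to be fixed before.
AvoidsFrom-upper⁺ : k < m → k < x → All (k <_) t → All (_< k) R →
  AvoidsFrom true m x t → AvoidsFrom true k k R → AvoidsFrom false m x (t ++ R ∷ʳ k)
AvoidsFrom-upper⁺ {k} {x = x} {R = R} k<m k<x [] <k (end _) av with <k | av
-- With `R` empty, `k` may be fixed in the first word, but here it joins the block of `m` and goes
-- to `m`.
... | [] | end _ = stay k<m [] (end (inj₂ (<⇒≢ k<m)))
... | s<k ∷ <k′ | stay _ _ av′ = stay (<-trans s<k k<m)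
  (All.++⁺ (All.map (λ y<k x<y → contradiction (<-trans k<x x<y) (<⇒≯ y<k)) <k′)
    ((λ x<k → contradiction k<x (<⇒≯ x<k)) ∷ [])) (AvoidsFrom-lower⁺ k<m <k′ av′ s<k)
... | s<k ∷ _ | jump k<s _ _ _ = contradiction k<s (<⇒≯ s<k)
AvoidsFrom-upper⁺ {k} {x = x} {R = R} k<m k<x (k<z ∷ k<) <k (stay z<m c av) av′ =
  stay z<m (All.++⁺ c (All.++⁺ (All.map (λ y<k x<y → contradiction (<-trans k<x x<y) (<⇒≯ y<k)) <k)
    ((λ x<k → contradiction k<x (<⇒≯ x<k)) ∷ []))) (AvoidsFrom-upper⁺ k<m k<z k< <k av av′)
AvoidsFrom-upper⁺ {k} {x = x} {R = R} k<m k<x (k<z ∷ k<) <k (jump m<z x≢m c av) av′ =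
  jump m<z x≢m (All.++⁺ c (All.++⁺ (All.map (λ y<k x<y → contradiction (<-trans k<x x<y) (<⇒≯ y<k)) <k)
    ((λ x<k → contradiction k<x (<⇒≯ x<k)) ∷ []))) (AvoidsFrom-upper⁺ k<z k<z k< <k av av′)

AvoidsFrom-upper⁻ : k < m → All (k <_) t → All (_< k) R → AvoidsFrom false m x (t ++ R ∷ʳ k) →
  AvoidsFrom true m x t × AvoidsFrom true k k R
AvoidsFrom-upper⁻ k<m [] [] _ = end (inj₁ _) , end (inj₁ _)
AvoidsFrom-upper⁻ k<m [] (s<k ∷ <k) (stay _ _ av) = end (inj₁ _) ,
  -- In the first word `k` heads this block; its condition is vacuous, as no letter of `R` exceeds
  -- `k`.
  stay s<k (All.map (λ y<k k<y → contradiction k<y (<⇒≯ y<k)) <k) (AvoidsFrom-lower⁻ k<m <k av)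
AvoidsFrom-upper⁻ k<m [] (s<k ∷ <k) (jump m<s _ _ _) = contradiction (<-trans k<m m<s) (<⇒≯ s<k)
AvoidsFrom-upper⁻ {t = _ ∷ t} k<m (k<z ∷ k<) <k (stay z<m c av) with av₁ , av₂ ← AvoidsFrom-upper⁻ k<m k< <k av =
  stay z<m (All.++⁻ˡ t c) av₁ , av₂
AvoidsFrom-upper⁻ {t = _ ∷ t} k<m (k<z ∷ k<) <k (jump m<z x≢m c av)
  with av₁ , av₂ ← AvoidsFrom-upper⁻ k<z k< <k av =
  jump m<z x≢m (All.++⁻ˡ t c) av₁ , av₂

-- Letters before the insertion keep their images: the last one returns to `m` whether `k` or `h`
-- opens the next block. These images are below `k`, hence below all inserted letters.
AvoidsFrom-glue⁺ : m < k → All (_< k) L → All (k <_) (h ∷ t) → All (_< k) R →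
  AvoidsFrom true m x (L ++ k ∷ R) → AvoidsFrom true h h t → AvoidsFrom false m x (L ++ (h ∷ t) ++ R ∷ʳ k)
AvoidsFrom-glue⁺ m<k [] _ _ (stay k<m _ _) _ = contradiction m<k (<⇒≯ k<m)
AvoidsFrom-glue⁺ m<k [] (k<h ∷ k<) <k (jump _ x≢m c av) av′ = jump (<-trans m<k k<h) x≢m
  (All-glue⁺ [] ((λ _ → <⇒≤ m<k) ∷ c) (All.map (λ k<y _ → <⇒≤ (<-trans m<k k<y)) k<))
  (AvoidsFrom-upper⁺ k<h k<h k< <k av′ av)
AvoidsFrom-glue⁺ {L = _ ∷ L} m<k (z<k ∷ L<k) k< <k (stay z<m c av) av′ = stay z<m
  (All-glue⁺ L c (All.map (λ k<y _ → <⇒≤ (<-trans z<k k<y)) k<))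
  (AvoidsFrom-glue⁺ m<k L<k k< <k av av′)
AvoidsFrom-glue⁺ {L = _ ∷ L} m<k (z<k ∷ L<k) k< <k (jump m<z x≢m c av) av′ = jump m<z x≢m
  (All-glue⁺ L c (All.map (λ k<y _ → <⇒≤ (<-trans m<k k<y)) k<))
  (AvoidsFrom-glue⁺ z<k L<k k< <k av av′)

AvoidsFrom-glue⁻ : m < k → All (_< k) L → All (k <_) (h ∷ t) → All (_< k) R →
  AvoidsFrom false m x (L ++ (h ∷ t) ++ R ∷ʳ k) → AvoidsFrom true m x (L ++ k ∷ R) × AvoidsFrom true h h t
AvoidsFrom-glue⁻ m<k [] (k<h ∷ _) _ (stay h<m _ _) = contradiction (<-trans m<k k<h) (<⇒≯ h<m)
AvoidsFrom-glue⁻ {t = t} m<k [] (k<h ∷ k<) <k (jump _ x≢m c av)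
  with av₁ , av₂ ← AvoidsFrom-upper⁻ k<h k< <k av = jump m<k x≢m (All.tail (All-glue⁻ [] t c)) av₂ , av₁
AvoidsFrom-glue⁻ {L = _ ∷ L} {h} {t} m<k (z<k ∷ L<k) k< <k (stay z<m c av)
  with av₁ , av₂ ← AvoidsFrom-glue⁻ m<k L<k k< <k av = stay z<m (All-glue⁻ L (h ∷ t) c) av₁ , av₂
AvoidsFrom-glue⁻ {L = _ ∷ L} {h} {t} m<k (z<k ∷ L<k) k< <k (jump m<z x≢m c av)
  with av₁ , av₂ ← AvoidsFrom-glue⁻ z<k L<k k< <k av = jump m<z x≢m (All-glue⁻ L (h ∷ t) c) av₁ , av₂

Avoids-glue⁺ : All (_< k) L → All (k <_) (h ∷ t) → All (_< k) R →
  Avoids true (L ++ k ∷ R) → Avoids true (h ∷ t) → Avoids false (L ++ (h ∷ t) ++ R ∷ʳ k)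
Avoids-glue⁺ [] (k<h ∷ k<) <k av av′ = AvoidsFrom-upper⁺ k<h k<h k< <k av′ av
Avoids-glue⁺ (x<k ∷ L<k) k< <k av av′ = AvoidsFrom-glue⁺ x<k L<k k< <k av av′

Avoids-glue⁻ : All (_< k) L → All (k <_) (h ∷ t) → All (_< k) R →
  Avoids false (L ++ (h ∷ t) ++ R ∷ʳ k) → Avoids true (L ++ k ∷ R) × Avoids true (h ∷ t)
Avoids-glue⁻ [] (k<h ∷ k<) <k av = swap× (AvoidsFrom-upper⁻ k<h k< <k av)
Avoids-glue⁻ (x<k ∷ L<k) k< <k av = AvoidsFrom-glue⁻ x<k L<k k< <k av

-- Cutting a word by its last letter

data Cut (k : ℕ) : List ℕ → Set where
  cut : ∀ {L h t R} → All (_< k) L → All (k <_) (h ∷ t) → All (_< k) R → Cut k (L ++ (h ∷ t) ++ R)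

-- The condition of `x` is tested against the final letter `k`: the image of `x < k` cannot lie
-- above `k`. This excludes a `jump`, where the image is `m`, and keeps the next letter below `k` in
-- a `stay`.
below-cut : k < m → x < k → All (_≢ k) vs → AvoidsFrom false m x (vs ∷ʳ k) → All (_< k) vs
below-cut k<m x<k [] _ = []
below-cut {vs = _ ∷ vs} k<m x<k (z≢k ∷ ≢k) (stay _ c av) =
  let z<k = ≤∧≢⇒< (All.head (All.++⁻ʳ vs c) x<k) z≢k in z<k ∷ below-cut k<m z<k ≢k av
below-cut {vs = _ ∷ vs} k<m x<k _ (jump m<z _ c _) = contradiction (All.head (All.++⁻ʳ vs c) x<k) (<⇒≱ k<m)

above-cut : k < m → All (_≢ k) vs → AvoidsFrom false m x (vs ∷ʳ k) →
  ∃₂ λ t R → vs ≡ t ++ R × All (k <_) t × All (_< k) R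
above-cut k<m [] _ = [] , [] , refl , [] , []
above-cut {k} {vs = z ∷ vs} k<m (z≢k ∷ ≢k) av with <-cmp z k | av
... | tri≈ _ z≡k _ | _ = contradiction z≡k z≢k
... | tri< z<k _ _ | stay _ _ av′ = [] , z ∷ vs , refl , [] , z<k ∷ below-cut k<m z<k ≢k av′
... | tri< z<k _ _ | jump m<z _ _ _ = contradiction (<-trans k<m m<z) (<⇒≯ z<k)
... | tri> _ _ k<z | stay _ _ av′ with t , R , refl , k< , <k ← above-cut k<m ≢k av′ =
  z ∷ t , R , refl , k<z ∷ k< , <k
above-cut {k} {vs = z ∷ vs} k<m (z≢k ∷ ≢k) av
    | tri> _ _ k<z | jump _ _ _ av′ with t , R , refl , k< , <k ← above-cut k<z ≢k av′ =
  z ∷ t , R , refl , k<z ∷ k< , <k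

-- A letter above `k` must come before the end, since otherwise the final `k` would be a block of
-- its own and thus a fixed point. From the first such letter on, `above-cut` applies.
AvoidsFrom⇒Cut : m < k → All (_≢ k) vs → AvoidsFrom false m x (vs ∷ʳ k) → Cut k vs
AvoidsFrom⇒Cut m<k [] (stay k<m _ _) = contradiction m<k (<⇒≯ k<m)
AvoidsFrom⇒Cut m<k [] (jump _ _ _ (end (inj₂ k≢k))) = contradiction refl k≢k
AvoidsFrom⇒Cut {k = k} {z ∷ vs} m<k (z≢k ∷ ≢k) av with <-cmp z k | av
... | tri≈ _ z≡k _ | _ = contradiction z≡k z≢k
... | tri< z<k _ _ | stay _ _ av′ with cut L<k k< <k ← AvoidsFrom⇒Cut m<k ≢k av′ = cut (z<k ∷ L<k) k< <k
AvoidsFrom⇒Cut {k = k} {z ∷ vs} m<k (z≢k ∷ ≢k) av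
    | tri< z<k _ _ | jump _ _ _ av′ with cut L<k k< <k ← AvoidsFrom⇒Cut z<k ≢k av′ = cut (z<k ∷ L<k) k< <k
AvoidsFrom⇒Cut {k = k} {z ∷ vs} m<k (z≢k ∷ ≢k) av
    | tri> _ _ k<z | stay z<m _ _ = contradiction (<-trans m<k k<z) (<⇒≯ z<m)
AvoidsFrom⇒Cut {k = k} {z ∷ vs} m<k (z≢k ∷ ≢k) av
    | tri> _ _ k<z | jump _ _ _ av′ with t , R , refl , k< , <k ← above-cut k<z ≢k av′ = cut [] (k<z ∷ k<) <k

Avoids⇒Cut : All (_≢ k) vs → Avoids false (vs ∷ʳ k) → Cut k vs
Avoids⇒Cut [] (end (inj₂ k≢k)) = contradiction refl k≢k
Avoids⇒Cut {k} {x ∷ vs} (x≢k ∷ ≢k) av with <-cmp x k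
... | tri≈ _ x≡k _ = contradiction x≡k x≢k
... | tri< x<k _ _ = below x<k (AvoidsFrom⇒Cut x<k ≢k av)
  where
  below : x < k → Cut k vs → Cut k (x ∷ vs)
  below x<k (cut L<k k< <k) = cut (x<k ∷ L<k) k< <k
... | tri> _ _ k<x with t , R , refl , k< , <k ← above-cut k<x ≢k av = cut [] (k<x ∷ k<) <k

-- Products and splitting at a threshold

length-cartesianProduct : ∀ (xs : List A) (ys : List B) → length (cartesianProduct xs ys) ≡ length xs * length ys
length-cartesianProduct [] ys = refl
length-cartesianProduct (x ∷ xs) ys = trans (length-++ (map (x ,_) ys))
  (cong₂ _+_ (length-map (x ,_) ys) (length-cartesianProduct xs ys))

++-unique : ∀ {as as′ bs bs′ : List A} → All P as → All P as′ → All (¬_ ∘ P) bs → All (¬_ ∘ P) bs′ →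
  as ++ bs ≡ as′ ++ bs′ → as ≡ as′ × bs ≡ bs′
++-unique [] [] _ _ eq = refl , eq
++-unique [] (p ∷ _) (¬p ∷ _) _ refl = contradiction p ¬p
++-unique (p ∷ _) [] _ (¬p ∷ _) refl = contradiction p ¬p
++-unique (_ ∷ ps) (_ ∷ ps′) ¬p ¬p′ eq
  with refl , eq′ ← ∷-injective eq
  with refl , eq″ ← ++-unique ps ps′ ¬p ¬p′ eq′ = refl , eq″

filter-++ˡ : ∀ {as bs : List A} (P? : Decidable P) → All P as → All (¬_ ∘ P) bs → filter P? (as ++ bs) ≡ as
filter-++ˡ {as = as} {bs} P? ps ¬ps = trans (filter-++ P? as bs)
  (trans (cong₂ _++_ (filter-all P? ps) (filter-none P? ¬ps)) (++-identityʳ as))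

filter-++ʳ : ∀ {as bs : List A} (P? : Decidable P) → All (¬_ ∘ P) as → All P bs → filter P? (as ++ bs) ≡ bs
filter-++ʳ {as = as} {bs} P? ¬ps ps = trans (filter-++ P? as bs)
  (cong₂ _++_ (filter-none P? ¬ps) (filter-all P? ps))

-- Filtering by the threshold recovers either part and respects rearrangement.
++-↭-split : ∀ k → All (_≤ k) as → All (_≤ k) as′ → All (k <_) bs → All (k <_) bs′ →
  as ++ bs ↭ as′ ++ bs′ → as ↭ as′ × bs ↭ bs′
++-↭-split k ≤k ≤k′ k< k<′ p =
  subst₂ _↭_ (filter-++ˡ (_≤? k) ≤k (All.map <⇒≱ k<)) (filter-++ˡ (_≤? k) ≤k′ (All.map <⇒≱ k<′))
    (filter-↭ (_≤? k) p) ,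
  subst₂ _↭_ (filter-++ʳ (k <?_) (All.map ≤⇒≯ ≤k) k<) (filter-++ʳ (k <?_) (All.map ≤⇒≯ ≤k′) k<′)
    (filter-↭ (k <?_) p)

∷ʳ-cancel-↭ : as ∷ʳ k ↭ bs ∷ʳ k → as ↭ bs
∷ʳ-cancel-↭ {as} {bs = bs} p = subst₂ _↭_ (++-identityʳ as) (++-identityʳ bs) (drop-mid as bs p)

All-↭[1‥] : π ↭ [1‥ n ] → All (λ x → 1 ≤ x × x ≤ n) π
All-↭[1‥] p = All.tabulate (∈-[1‥]⁻ ∘ ∈-resp-↭ p)

Unique-∷ʳ : ∀ vs → Unique (vs ∷ʳ k) → All (_≢ k) vs
Unique-∷ʳ [] _ = []
Unique-∷ʳ (x ∷ vs) (x≢ ∷ u) = All.head (All.++⁻ʳ vs x≢) ∷ Unique-∷ʳ vs u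

-- Relaxed avoiders

-- Permutations of [k] whose avoidance is only required up to k being a fixed point in last position.
relaxedAvoiders : ℕ → List (List ℕ)
relaxedAvoiders k = avoiders k ++ map (_∷ʳ k) (avoiders (k ∸ 1))

length-relaxedAvoiders : ∀ k → length (relaxedAvoiders k) ≡ a k + a (k ∸ 1)
length-relaxedAvoiders k = trans (length-++ (avoiders k))
  (cong (a k +_) (length-map (_∷ʳ k) (avoiders (k ∸ 1))))

relaxedAvoiders⁺ : π ↭ [1‥ suc j ] → Avoids true π → π ∈ relaxedAvoiders (suc j)
relaxedAvoiders⁺ {[]} p _ with () ← ↭-length p
relaxedAvoiders⁺ {x ∷ vs} {j} p av with Avoids-strengthen av
... | inj₁ av′ = ∈-++⁺ˡ (∈-avoiders⁺ (suc j) p av′)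
... | inj₂ (ws , k , eq , ws<k , av′) =
  ∈-++⁺ʳ (avoiders (suc j)) (subst (_∈ map (_∷ʳ suc j) (avoiders j)) (sym eq′)
    (∈-map⁺ (_∷ʳ suc j) (∈-avoiders⁺ j (∷ʳ-cancel-↭ ws↭) av′)))
  where
  -- `k` is a letter, hence at most `suc j`; it also bounds all letters, and `suc j` is one of them.
  k≡ : k ≡ suc j
  k≡ = ≤-antisym
    (proj₂ (∈-[1‥]⁻ (∈-resp-↭ p (subst (k ∈_) (sym eq) (∈-++⁺ʳ ws (here refl))))))
    (All.lookup (All.++⁺ (All.map <⇒≤ ws<k) (≤-refl ∷ []))
      (subst (suc j ∈_) eq (∈-resp-↭ (↭-sym p) (∈-[1‥]⁺ (s≤s z≤n) ≤-refl))))
  eq′ : x ∷ vs ≡ ws ∷ʳ suc j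
  eq′ = trans eq (cong (ws ∷ʳ_) k≡)
  ws↭ : ws ∷ʳ suc j ↭ [1‥ j ] ∷ʳ suc j
  ws↭ = subst₂ _↭_ eq′ (sym (applyUpTo-∷ʳ suc j)) p

relaxedAvoiders⁻ : ∀ j → π ∈ relaxedAvoiders (suc j) → π ↭ [1‥ suc j ] × Avoids true π
relaxedAvoiders⁻ {π} j π∈ with ∈-++⁻ (avoiders (suc j)) π∈
... | inj₁ π∈₁ = let p , av = ∈-avoiders⁻ (suc j) π∈₁ in p , Avoids-weaken π av
... | inj₂ π∈₂ with ws , ws∈ , refl ← ∈-map⁻ (_∷ʳ suc j) π∈₂ =
  let p , av = ∈-avoiders⁻ j ws∈ in
  subst (ws ∷ʳ suc j ↭_) (applyUpTo-∷ʳ suc j) (++⁺ʳ (suc j ∷ []) p) ,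
  Avoids-∷ʳ ws (All.map (s≤s ∘ proj₂) (All-↭[1‥] p)) av

Unique-relaxedAvoiders : ∀ j → Unique (relaxedAvoiders (suc j))
Unique-relaxedAvoiders j = Unique.++⁺ (Unique-avoiders (suc j))
  (Unique.map⁺ (∷ʳ-injectiveˡ _ _) (Unique-avoiders j)) disjoint
  where
  no-cut : (∀ {x} → x ∈ vs → x ≤ j) → ¬ Cut (suc j) vs
  no-cut ≤j (cut {L} _ (k<h ∷ _) _) = <⇒≱ k<h (m≤n⇒m≤1+n (≤j (∈-++⁺ʳ L (here refl))))
  -- By `Avoids⇒Cut` a genuine avoider ending in `suc j` would contain a letter above `suc j`.
  disjoint : ¬ (π ∈ avoiders (suc j) × π ∈ map (_∷ʳ suc j) (avoiders j))
  disjoint (π∈₁ , π∈₂) with ws , ws∈ , refl ← ∈-map⁻ (_∷ʳ suc j) π∈₂ =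
    let p , av = ∈-avoiders⁻ (suc j) π∈₁
        q , _ = ∈-avoiders⁻ j ws∈
    in no-cut (proj₂ ∘ ∈-[1‥]⁻ ∘ ∈-resp-↭ q) (Avoids⇒Cut (Unique-∷ʳ ws (↭[1‥]⇒Unique p)) av)

-- The gluing correspondence

-- The bijection behind the recurrence: the letter k of the first word is replaced by a copy of the
-- second word on the letters above k, and k itself is moved to the end.
data Glue : List ℕ × List ℕ → List ℕ → Set where
  glue : ∀ {α h t π L R k} → All (_< k) L → All (k <_) (map (k +_) (h ∷ t)) → All (_< k) R →
         α ≡ L ++ k ∷ R → π ≡ L ++ map (k +_) (h ∷ t) ++ R ∷ʳ k → Glue (α , h ∷ t) π

++-assoc₃ : ∀ (as bs cs ds : List A) → as ++ bs ++ cs ++ ds ≡ (as ++ bs ++ cs) ++ ds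
++-assoc₃ as bs cs ds = sym (trans (++-assoc as (bs ++ cs) ds) (cong (as ++_) (++-assoc bs cs ds)))

-- The pair is read off `π`: `k` is its last letter, `L` ends before the first letter above `k`, and
-- the shifted second word is the run above `k` that follows.
Glue-injective : ∀ {p q} → Glue p π → Glue q π → p ≡ q
Glue-injective (glue {h = h} {t} {L = L} {R} {k} L<k k<@(k<h ∷ _) <k refl refl)
  (glue {h = h′} {t′} {L = L′} {R′} {k′} L′<k k<′@(k<h′ ∷ _) <k′ refl eq)
  with eq₁ , refl ← ∷ʳ-injective (L ++ map (k +_) (h ∷ t) ++ R) (L′ ++ map (k′ +_) (h′ ∷ t′) ++ R′)
    (trans (sym (++-assoc₃ L (map (k +_) (h ∷ t)) R (k ∷ [])))
      (trans eq (++-assoc₃ L′ (map (k′ +_) (h′ ∷ t′)) R′ (k′ ∷ []))))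
  with refl , eq₂ ← split-unique L<k L′<k (<⇒≯ k<h) (<⇒≯ k<h′) eq₁
  with eq₃ , refl ← ++-unique k< k<′ (All.map <⇒≯ <k) (All.map <⇒≯ <k′) eq₂
  = cong (L ++ k ∷ R ,_) (map-injective (+-cancelˡ-≡ k _ _) eq₃)

max-unique : ∀ {L L′ R R′ : List ℕ} {k k′} → All (_< k) L → All (_< k) R → All (_< k′) L′ → All (_< k′) R′ →
  L ++ k ∷ R ≡ L′ ++ k′ ∷ R′ → k ≡ k′
max-unique {L} {L′} L<k R<k L′<k R″<k eq = ≤-antisym
  (All.lookup (subst (All (_≤ _)) (sym eq) (bound L′<k R″<k)) (∈-++⁺ʳ L (here refl)))
  (All.lookup (subst (All (_≤ _)) eq (bound L<k R<k)) (∈-++⁺ʳ L′ (here refl)))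
  where
  bound : ∀ {L R k} → All (_< k) L → All (_< k) R → All (_≤ k) (L ++ k ∷ R)
  bound L<k R<k = All.++⁺ (All.map <⇒≤ L<k) (≤-refl ∷ All.map <⇒≤ R<k)

-- The first word determines `k` as its maximum, and the place of `k` determines `L` and `R`.
Glue-functional : ∀ {p} → Glue p π → Glue p σ → π ≡ σ
Glue-functional (glue L<k _ R<k refl refl) (glue L′<k _ R′<k eq refl)
  with refl ← max-unique L<k R<k L′<k R′<k eq
  with refl , refl ← split-unique L<k L′<k (<-irrefl refl) (<-irrefl refl) eq = refl

glue-↭ : ∀ (L B R : List ℕ) k → L ++ B ++ R ∷ʳ k ↭ (L ++ k ∷ R) ++ B
glue-↭ L B R k = begin
  L ++ B ++ R ∷ʳ k     ↭⟨ ++⁺ˡ L (++-comm B (R ∷ʳ k)) ⟩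
  L ++ R ∷ʳ k ++ B     ↭⟨ ++⁺ˡ L (++⁺ʳ B (∷↭∷ʳ k R)) ⟨
  L ++ (k ∷ R) ++ B    ≡⟨ ++-assoc L (k ∷ R) B ⟨
  (L ++ k ∷ R) ++ B    ∎
  where open PermutationReasoning

map-+-> : ∀ k → All (1 ≤_) bs → All (k <_) (map (k +_) bs)
map-+-> k 1≤ = All.map⁺ (All.map (m<m+n k) 1≤)

∈-relaxedAvoiders⇒glue : ∀ j → as ∈ relaxedAvoiders (suc j) → bs ∈ relaxedAvoiders (suc l) →
  ∃ λ π → π ∈ avoiders (suc j + suc l) × Glue (as , bs) π
∈-relaxedAvoiders⇒glue {as} {[]} {l} j _ bs∈ with () ← ↭-length (proj₁ (relaxedAvoiders⁻ l bs∈))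
∈-relaxedAvoiders⇒glue {as} {h ∷ t} {l} j as∈ bs∈
  with p , av ← relaxedAvoiders⁻ j as∈ | q , av′ ← relaxedAvoiders⁻ l bs∈
  -- The letter to be replaced is the largest one of the first word, `suc j`.
  with L , R , refl ← ∈-∃++ (∈-resp-↭ (↭-sym p) (∈-[1‥]⁺ (s≤s z≤n) ≤-refl)) =
  τ , ∈-avoiders⁺ (suc j + suc l) τ↭ (Avoids-glue⁺ L<k k< R<k av (AvoidsFrom-shift⁺ (suc j) av′)) ,
  glue L<k k< R<k refl refl
  where
  τ = L ++ map (suc j +_) (h ∷ t) ++ R ∷ʳ suc j
  L++R↭ : L ++ R ↭ [1‥ j ]
  L++R↭ = subst (L ++ R ↭_) (++-identityʳ [1‥ j ])
    (drop-mid L [1‥ j ] (subst (L ++ suc j ∷ R ↭_) (sym (applyUpTo-∷ʳ suc j)) p))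
  <k : All (_< suc j) (L ++ R)
  <k = All.map (s≤s ∘ proj₂) (All-↭[1‥] L++R↭)
  L<k = All.++⁻ˡ L <k
  R<k = All.++⁻ʳ L <k
  k< = map-+-> (suc j) (All.map proj₁ (All-↭[1‥] q))
  τ↭ : τ ↭ [1‥ suc j + suc l ]
  τ↭ = subst (τ ↭_) (sym ([1‥]-+ (suc j) (suc l)))
    (↭-trans (glue-↭ L (map (suc j +_) (h ∷ t)) R (suc j)) (++⁺ p (map⁺ (suc j +_) q)))

∈-avoiders⇒glue : 1 ≤ n → π ∈ avoiders n →
  ∃₂ λ j l → n ≡ suc j + suc l × ∃₂ λ as bs →
    as ∈ relaxedAvoiders (suc j) × bs ∈ relaxedAvoiders (suc l) × Glue (as , bs) π
∈-avoiders⇒glue {n} {π} 1≤n π∈ with p , av ← ∈-avoiders⁻ n π∈ with initLast π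
... | [] = contradiction (↭[1‥]⇒length p) (<⇒≢ 1≤n)
... | vs ∷ʳ′ k with k∈ ← ∈-[1‥]⁻ (∈-resp-↭ p (∈-++⁺ʳ vs (here refl)))
  with 1≤k , k≤n ← k∈
  with cut {L} {h} {t} {R} L<k k< R<k ← Avoids⇒Cut (Unique-∷ʳ vs (↭[1‥]⇒Unique p)) av
  with m≤n⇒∃[o]m+o≡n k≤n | m≤n⇒∃[o]m+o≡n 1≤k
... | l , refl | j , refl
  -- Values up to `k` make up the first word, values above `k` the middle part.
  with α↭ , B↭ ← ++-↭-split k (All.++⁺ (All.map <⇒≤ L<k) (≤-refl ∷ All.map <⇒≤ R<k))
    (All.tabulate (proj₂ ∘ ∈-[1‥]⁻)) k< (map-+-> k (All.tabulate (proj₁ ∘ ∈-[1‥]⁻)))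
    (↭-trans (↭-sym (glue-↭ L (h ∷ t) R k))
      (subst₂ _↭_ (sym (++-assoc₃ L (h ∷ t) R (k ∷ []))) ([1‥]-+ k l) p))
  -- A rearrangement of the shifted interval is itself a shifted word; as it is nonempty, `l` is
  -- positive.
  with h′ ∷ t′ , refl , β↭ ← ↭-map-inv (k +_) (↭-sym B↭)
  with refl ← ↭[1‥]⇒length (↭-sym β↭)
  with av₁ , av₂ ← Avoids-glue⁻ L<k k< R<k (subst (Avoids false) (sym (++-assoc₃ L (h ∷ t) R (k ∷ []))) av)
  = j , length t′ , refl , L ++ k ∷ R , h′ ∷ t′ ,
    relaxedAvoiders⁺ α↭ av₁ , relaxedAvoiders⁺ (↭-sym β↭) (AvoidsFrom-shift⁻ k av₂) ,
    glue L<k k< R<k refl (sym (++-assoc₃ L (h ∷ t) R (k ∷ [])))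

-- Counting the pairs

pairs : ℕ → List (List ℕ × List ℕ)
pairs n = concatMap (λ j → cartesianProduct (relaxedAvoiders (suc j)) (relaxedAvoiders (n ∸ suc j))) (upTo (n ∸ 1))

length-pairs : ∀ n → length (pairs n) ≡ rhs n
length-pairs n = trans (length-concatMap _ (upTo (n ∸ 1))) (cong sum (map-cong
  (λ j → trans (length-cartesianProduct (relaxedAvoiders (suc j)) (relaxedAvoiders (n ∸ suc j)))
    (cong₂ _*_ (length-relaxedAvoiders (suc j)) (length-relaxedAvoiders (n ∸ suc j))))
  (upTo (n ∸ 1))))

-- The range stops one short of `n`, which leaves positive length for the second word.
∈-upTo-pred : j ∈ upTo (n ∸ 1) → ∃ λ l → n ≡ suc j + suc l
∈-upTo-pred {n = suc n} j∈ with l , eq ← m≤n⇒∃[o]m+o≡n (∈-upTo⁻ j∈) =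
  l , cong suc (trans (sym eq) (sym (+-suc _ l)))

∈-pairs⁻ : ∀ n {as bs} → (as , bs) ∈ pairs n → ∃₂ λ j l → n ≡ suc j + suc l ×
  as ∈ relaxedAvoiders (suc j) × bs ∈ relaxedAvoiders (suc l)
∈-pairs⁻ n {bs = bs} p∈
  with j , j∈ , q ← find (∈-concatMap⁻ (λ j → cartesianProduct (relaxedAvoiders (suc j)) (relaxedAvoiders (n ∸ suc j))) p∈)
  with l , refl ← ∈-upTo-pred {n = n} j∈
  with as∈ , bs∈ ← ∈-cartesianProduct⁻ (relaxedAvoiders (suc j)) _ q =
  j , l , refl , as∈ , subst ((bs ∈_) ∘ relaxedAvoiders) (m+n∸m≡n (suc j) (suc l)) bs∈

∈-pairs⁺ : ∀ j l {as bs} → as ∈ relaxedAvoiders (suc j) → bs ∈ relaxedAvoiders (suc l) →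
  (as , bs) ∈ pairs (suc j + suc l)
∈-pairs⁺ j l {bs = bs} as∈ bs∈ = ∈-concatMap⁺ _ (lose (∈-upTo⁺ (m<m+n j (s≤s z≤n)))
  (∈-cartesianProduct⁺ as∈ (subst ((bs ∈_) ∘ relaxedAvoiders) (sym (m+n∸m≡n (suc j) (suc l))) bs∈)))

Unique-pairs : ∀ n → Unique (pairs n)
Unique-pairs n = Unique-concatMap (Unique.upTo⁺ (n ∸ 1)) unique separate
  where
  unique : j ∈ upTo (n ∸ 1) → Unique (cartesianProduct (relaxedAvoiders (suc j)) (relaxedAvoiders (n ∸ suc j)))
  unique {j} j∈ with l , eq ← ∈-upTo-pred {n = n} j∈ = Unique.cartesianProduct⁺ (Unique-relaxedAvoiders j)
    (subst (Unique ∘ relaxedAvoiders) (sym (trans (cong (_∸ suc j) eq) (m+n∸m≡n (suc j) (suc l))))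
      (Unique-relaxedAvoiders l))
  separate : ∀ {i j p} → i ∈ upTo (n ∸ 1) → j ∈ upTo (n ∸ 1) →
    p ∈ cartesianProduct (relaxedAvoiders (suc i)) (relaxedAvoiders (n ∸ suc i)) →
    p ∈ cartesianProduct (relaxedAvoiders (suc j)) (relaxedAvoiders (n ∸ suc j)) → i ≡ j
  -- The length of the first word tells the summands apart.
  separate {i} {j} _ _ p q = suc-injective (trans (sym (length≡ i p)) (length≡ j q))
    where
    length≡ : ∀ i {as bs ys} → (as , bs) ∈ cartesianProduct (relaxedAvoiders (suc i)) ys → length as ≡ suc i
    length≡ i p = ↭[1‥]⇒length (proj₁ (relaxedAvoiders⁻ i (proj₁ (∈-cartesianProduct⁻ _ _ p))))

theorem6p2 : (n : ℕ) → 1 ≤ n → a n ≡ rhs n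
theorem6p2 n 1≤n = trans (≤-antisym a≤ ≤a) (length-pairs n)
  where
  a≤ : a n ≤ length (pairs n)
  -- `Glue` is used in both directions: here each avoider is matched with a pair it is glued from,
  -- below each pair with a word glued from it.
  a≤ = length-≤-injective {R = λ π p → Glue p π} (Unique-avoiders n)
    (λ π∈ → let j , l , eq , as , bs , as∈ , bs∈ , g = ∈-avoiders⇒glue 1≤n π∈
            in (as , bs) , subst (λ n → (as , bs) ∈ pairs n) (sym eq) (∈-pairs⁺ j l as∈ bs∈) , g)
    Glue-functional
  ≤a : length (pairs n) ≤ a n
  ≤a = length-≤-injective {R = Glue} (Unique-pairs n)
    (λ p∈ → let j , l , eq , as∈ , bs∈ = ∈-pairs⁻ n p∈
                π , π∈ , g = ∈-relaxedAvoiders⇒glue j as∈ bs∈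
            in π , subst (λ n → π ∈ avoiders n) (sym eq) π∈ , g)
    Glue-injective
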